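{- Let $q$ be a prime number, let $l\ge 2$ be an integer and let $N=q^{l}$. Then $$\mathbb{Z}\text{ - }\mathcal{KS}(N)=\{\,q+d,\ q-d\;:\; d \text{ a positive integer with } d\mid (q^{l}-q)\}\setminus\{0,N\}.$$
   Context: Every nonzero rational $\alpha$ is written $\alpha=\alpha_1/\alpha_2$ with $\alpha_1\in\mathbb{Z}$, $\alpha_2$ a positive integer and $\gcd(\alpha_1,\alpha_2)=1$ (for $\alpha\in\mathbb{Z}$ this means $\alpha_2=1$). For an integer $N\ge 2$ and a nonzero rational $\alpha=\alpha_1/\alpha_2$, $N$ is called an $\alpha$-Korselt number if $N\neq\alpha$ and $\alpha_2p-\alpha_1$ divides $\alpha_2N-\alpha_1$ (in $\mathbb{Z}$) for every prime divisor $p$ of $N$. For a subset $\mathbb{A}\subseteq\mathbb{Q}$, the Korselt set $\mathbb{A}\text{ - }\mathcal{KS}(N)$ is the set of all $\beta\in\mathbb{A}\setminus\{0,N\}$ such that $N$ is a $\beta$-Korselt number. -}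

module Defs where

open import Data.Integer using (ℤ; +_; _*_; _-_)
open import Data.Integer.Divisibility.Signed using (_∣_)
open import Data.Nat using (ℕ; _≤_)
import Data.Nat.Divisibility as ℕ
open import Data.Nat.Primality using (Prime)
open import Data.Product using (∃-syntax)
open import Data.Rational using (ℚ; 0ℚ; _/_; ↥_; ↧_)
open import Level using (Level; 0ℓ)
open import Relation.Binary.PropositionalEquality using (_≡_; _≢_)
open import Relation.Unary using (Pred; _∩_; _∪_; _∖_; ｛_｝)

private
  variable
    ℓ : Level

fromℤ : ℤ → ℚ
fromℤ i = i / 1

fromℕ : ℕ → ℚ
fromℕ n = fromℤ (+ n)

ℤ-in-ℚ : Pred ℚ 0ℓ
ℤ-in-ℚ α = ∃[ i ] α ≡ fromℤ i

-- Elements of ℚ are stored in lowest terms with a positive denominator, so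
-- α₁ = ↥ α and α₂ = ↧ α.  The signed divisibility relation on ℤ is used, and
-- 0 divides only 0.
record IsKorselt (α : ℚ) (N : ℕ) : Set where
  field
    N≥2      : 2 ≤ N
    α≢0      : α ≢ 0ℚ
    N≢α      : fromℕ N ≢ α
    divides  : ∀ p → Prime p → p ℕ.∣ N →
               (↧ α * + p - ↥ α) ∣ (↧ α * + N - ↥ α)

KorseltSet : Pred ℚ ℓ → ℕ → Pred ℚ ℓ
KorseltSet A N =
  (A ∖ (｛ 0ℚ ｝ ∪ ｛ fromℕ N ｝)) ∩ (λ β → IsKorselt β N)

{-# OPTIONS --safe #-}
-- The only prime divisor of q ^ l is q, so an integer i is a Korselt base of
-- q ^ l iff q - i divides q ^ l - i = (q ^ l - q) + (q - i), that is, iff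
-- q - i divides q ^ l - q.  As q ^ l ≢ q, such a divisor is nonzero, and
-- d = ∣ q - i ∣ gives i = q ± d.

module Submission where

open import Data.Integer using (ℤ; +_; -_; 0ℤ; ∣_∣; _+_; _*_; _-_)
open import Data.Integer.Divisibility.Signed
  using (_∣_; 0∣⇒≡0; m∣∣m∣; ∣m∣∣m; ∣-refl; ∣-trans; ∣m∣n⇒∣m+n; ∣m+n∣n⇒∣m)
import Data.Integer.GCD as ℤ
import Data.Integer.Properties as ℤ
open import Data.Integer.Tactic.RingSolver using (solve-∀)
open import Data.Nat using (ℕ; zero; suc; _≤_; _<_; _^_)
import Data.Nat as ℕ
import Data.Nat.Divisibility as ℕ
import Data.Nat.Properties as ℕ
open import Data.Nat.Primality
  using (Prime; euclidsLemma; prime⇒irreducible; prime⇒nonTrivial; ¬prime[1])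
open import Data.Product using (_×_; _,_; ∃-syntax)
open import Data.Rational using (0ℚ; ↥_; ↧_)
import Data.Rational.Properties as ℚ
open import Data.Sum using (_⊎_; inj₁; inj₂; [_,_]′)
import Data.Sum as Sum
open import Function using (_∘_; id)
open import Relation.Binary.PropositionalEquality
  using (_≡_; _≢_; refl; sym; trans; cong; cong₂; subst; subst₂; module ≡-Reasoning)
open import Relation.Nullary using (contradiction)
open import Relation.Unary using (_≐_; _∖_; _∪_; ｛_｝)
open import Defs

-- `fromℤ i` passes through a reduction to lowest terms that does not compute for a variable `i`.
-- The gcd divided out is `gcd i 1`, which is 1.
↥-fromℤ : ∀ i → ↥ fromℤ i ≡ i
↥-fromℤ i = begin
  ↥ fromℤ i                      ≡⟨ ℤ.*-identityʳ _ ⟨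
  ↥ fromℤ i * + 1                ≡⟨ cong (↥ fromℤ i *_) (ℤ.gcd-zeroʳ i) ⟨
  ↥ fromℤ i * ℤ.gcd i (+ 1)      ≡⟨ ℚ.↥-/ i 1 ⟩
  i                              ∎
  where open ≡-Reasoning

↧-fromℤ : ∀ i → ↧ fromℤ i ≡ + 1
↧-fromℤ i = begin
  ↧ fromℤ i                      ≡⟨ ℤ.*-identityʳ _ ⟨
  ↧ fromℤ i * + 1                ≡⟨ cong (↧ fromℤ i *_) (ℤ.gcd-zeroʳ i) ⟨
  ↧ fromℤ i * ℤ.gcd i (+ 1)      ≡⟨ ℚ.↧-/ i 1 ⟩
  + 1                            ∎
  where open ≡-Reasoning

-- Translates both sides of the Korselt divisibility at an integer base into plain integer
-- differences.
↧*-↥-fromℤ : ∀ i j → ↧ fromℤ i * j - ↥ fromℤ i ≡ j - i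
↧*-↥-fromℤ i j = cong₂ _-_
  (trans (cong (_* j) (↧-fromℤ i)) (ℤ.*-identityˡ j)) (↥-fromℤ i)

prime∣^⇒∣ : ∀ {p} m n → Prime p → p ℕ.∣ m ^ n → p ℕ.∣ m
prime∣^⇒∣ m zero    p-prime p∣1 =
  contradiction (subst Prime (ℕ.∣1⇒≡1 p∣1) p-prime) ¬prime[1]
prime∣^⇒∣ m (suc n) p-prime p∣m^1+n =
  [ id , prime∣^⇒∣ m n p-prime ]′ (euclidsLemma m (m ^ n) p-prime p∣m^1+n)

prime∣prime⇒≡ : ∀ {p q} → Prime p → Prime q → p ℕ.∣ q → p ≡ q
prime∣prime⇒≡ p-prime q-prime p∣q with prime⇒irreducible q-prime p∣q
... | inj₁ refl = contradiction p-prime ¬prime[1]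
... | inj₂ p≡q  = p≡q

prime⇒>1 : ∀ {p} → Prime p → 1 < p
prime⇒>1 {p} p-prime = ℕ.nonTrivial⇒n>1 p
  where instance _ = prime⇒nonTrivial p-prime

m<m^n : ∀ {m n} → 1 < m → 1 < n → m < m ^ n
m<m^n {m} {n} 1<m 1<n = subst (_< m ^ n) (ℕ.^-identityʳ m) (ℕ.^-monoʳ-< m 1<m 1<n)

m∣m^n : ∀ m {n} → 0 < n → m ℕ.∣ m ^ n
m∣m^n m {suc n} _ = ℕ.m∣m*n (m ^ n)

-- Since `k - j` is `(k - i) + (i - j)`, the divisor itself can be cancelled from the sum.
i-j∣k-j⇒i-j∣k-i : ∀ i j k → i - j ∣ k - j → i - j ∣ k - i
i-j∣k-j⇒i-j∣k-i i j k h = ∣m+n∣n⇒∣m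
  (subst (i - j ∣_) (sym (ℤ.+-minus-telescope k i j)) h) ∣-refl

i-j∣k-i⇒i-j∣k-j : ∀ i j k → i - j ∣ k - i → i - j ∣ k - j
i-j∣k-i⇒i-j∣k-j i j k h =
  subst (i - j ∣_) (ℤ.+-minus-telescope k i j) (∣m∣n⇒∣m+n h ∣-refl)

i-[i-j]≡j : ∀ i j → i - (i - j) ≡ j
i-[i-j]≡j = solve-∀

i-[i+j]≡-j : ∀ i j → i - (i + j) ≡ - j
i-[i+j]≡-j = solve-∀

-- The witness is the distance from `i` to `j`. It is positive because 0 divides only 0, while `k`
-- is nonzero.
difference∣⇒± : ∀ i j {k} → k ≢ 0ℤ → i - j ∣ k →
                ∃[ d ] (0 < d × (+ d) ∣ k × (j ≡ i + + d ⊎ j ≡ i - + d))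
difference∣⇒± i j {k} k≢0 i-j∣k =
  ∣ i - j ∣ , ℕ.n≢0⇒n>0 ∣i-j∣≢0 , ∣-trans ∣m∣∣m i-j∣k ,
  -- If `i - j` equals its absolute value `d`, then `j` is `i - d`, the second alternative of the
  -- goal; hence the swap.
  Sum.swap (Sum.map (λ eq → sym (trans (cong (λ k → i - k) eq) (i-[i-j]≡j i j)))
                    (λ eq → sym (trans (cong (λ k → i + k) eq) (i-[i-j]≡j i j)))
                    (ℤ.+∣i∣≡i⊎+∣i∣≡-i (i - j)))
  where
  ∣i-j∣≢0 : ∣ i - j ∣ ≢ 0
  ∣i-j∣≢0 eq = k≢0 (0∣⇒≡0 (subst (_∣ k) (ℤ.∣i∣≡0⇒i≡0 eq) i-j∣k))

∣difference∣≡ : ∀ i j d → j ≡ i + + d ⊎ j ≡ i - + d → ∣ i - j ∣ ≡ d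
∣difference∣≡ i _ d (inj₁ refl) =
  trans (cong ∣_∣ (i-[i+j]≡-j i (+ d))) (ℤ.∣-i∣≡∣i∣ (+ d))
∣difference∣≡ i _ d (inj₂ refl) = cong ∣_∣ (i-[i-j]≡j i (+ d))

-- Divisibility ignores the sign of the divisor, so `i - j` may be replaced by its absolute value,
-- which is `d`.
±⇒difference∣ : ∀ i j d {k} → (+ d) ∣ k → j ≡ i + + d ⊎ j ≡ i - + d → i - j ∣ k
±⇒difference∣ i j d {k} d∣k j≡i±d = ∣-trans m∣∣m∣
  (subst (λ e → (+ e) ∣ k) (sym (∣difference∣≡ i j d j≡i±d)) d∣k)

module _ {q l : ℕ} (q-prime : Prime q) (2≤l : 2 ≤ l) where

  private
    q<q^l : q < q ^ l
    q<q^l = m<m^n (prime⇒>1 q-prime) 2≤l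

    q^l-q≢0 : + (q ^ l) - + q ≢ 0ℤ
    q^l-q≢0 eq = ℕ.<⇒≢ q<q^l (sym (ℤ.+-injective (ℤ.i-j≡0⇒i≡j _ _ eq)))

    q∣q^l : q ℕ.∣ q ^ l
    q∣q^l = m∣m^n q (ℕ.<⇒≤ 2≤l)

  -- Instantiates the Korselt condition at the single prime `q`.
  korselt⇒∣ : ∀ i → IsKorselt (fromℤ i) (q ^ l) → + q - i ∣ + (q ^ l) - + q
  korselt⇒∣ i K = i-j∣k-j⇒i-j∣k-i (+ q) i (+ (q ^ l))
    (subst₂ _∣_ (↧*-↥-fromℤ i (+ q)) (↧*-↥-fromℤ i (+ (q ^ l)))
      (IsKorselt.divides K q q-prime q∣q^l))

  ∣⇒korselt : ∀ i → fromℤ i ≢ 0ℚ → fromℕ (q ^ l) ≢ fromℤ i →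
              + q - i ∣ + (q ^ l) - + q → IsKorselt (fromℤ i) (q ^ l)
  ∣⇒korselt i i≢0 N≢i h = record
    { N≥2     = ℕ.≤-trans (prime⇒>1 q-prime) (ℕ.<⇒≤ q<q^l)
    ; α≢0     = i≢0
    ; N≢α     = N≢i
    ; divides = λ p p-prime p∣q^l →
        -- A prime `p` dividing `q ^ l` divides `q` by Euclid's lemma, so it equals `q`, and the
        -- condition at `q` transfers to `p`.
        subst (λ r → ↧ fromℤ i * + r - ↥ fromℤ i ∣ ↧ fromℤ i * + (q ^ l) - ↥ fromℤ i)
          (sym (prime∣prime⇒≡ p-prime q-prime (prime∣^⇒∣ q l p-prime p∣q^l)))
          (subst₂ _∣_ (sym (↧*-↥-fromℤ i (+ q))) (sym (↧*-↥-fromℤ i (+ (q ^ l))))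
            (i-j∣k-i⇒i-j∣k-j (+ q) i (+ (q ^ l)) h))
    }

  ±⇒∈KorseltSet : ∀ i d → fromℤ i ≢ 0ℚ → fromℕ (q ^ l) ≢ fromℤ i →
                  (+ d) ∣ + (q ^ l) - + q → i ≡ + q + + d ⊎ i ≡ + q - + d →
                  KorseltSet ℤ-in-ℚ (q ^ l) (fromℤ i)
  ±⇒∈KorseltSet i d i≢0 N≢i d∣ i≡q±d =
    -- Membership in `｛ 0ℚ ｝` unfolds to `0ℚ ≡ fromℤ i`, opposite in direction to `i≢0`.
    ((i , refl) , [ i≢0 ∘ sym , N≢i ]′) ,
    ∣⇒korselt i i≢0 N≢i (±⇒difference∣ (+ q) i d d∣ i≡q±d)

  korselt⇒± : ∀ i → IsKorselt (fromℤ i) (q ^ l) →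
                  ∃[ d ] (0 < d × (+ d) ∣ + (q ^ l) - + q
                        × (i ≡ + q + + d ⊎ i ≡ + q - + d))
  korselt⇒± i K = difference∣⇒± (+ q) i q^l-q≢0 (korselt⇒∣ i K)

theorem3p2 : ∀ (q l : ℕ) → Prime q → 2 ≤ l →
    KorseltSet ℤ-in-ℚ (q ^ l)
      ≐ ((λ β → ∃[ d ] (0 < d
                      × (+ d) ∣ (+ (q ^ l) - + q)
                      × (β ≡ fromℤ (+ q + + d) ⊎ β ≡ fromℤ (+ q - + d))))
         ∖ (｛ 0ℚ ｝ ∪ ｛ fromℕ (q ^ l) ｝))
theorem3p2 q l q-prime 2≤l = ⊆ , ⊇
  where
  ⊆ : ∀ {β} → KorseltSet ℤ-in-ℚ (q ^ l) β → _
  -- Matching `refl` turns `β` into `fromℤ i`, so the search for `d` takes place in the integers and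
  -- `cong fromℤ` carries the result back.
  ⊆ (((i , refl) , β∉) , K) =
    let d , 0<d , d∣ , i≡q±d = korselt⇒± q-prime 2≤l i K
    in (d , 0<d , d∣ , Sum.map (cong fromℤ) (cong fromℤ) i≡q±d) , β∉

  ⊇ : ∀ {β} → _ → KorseltSet ℤ-in-ℚ (q ^ l) β
  ⊇ ((d , _ , d∣ , inj₁ refl) , β∉) =
    ±⇒∈KorseltSet q-prime 2≤l (+ q + + d) d (β∉ ∘ inj₁ ∘ sym) (β∉ ∘ inj₂) d∣ (inj₁ refl)
  ⊇ ((d , _ , d∣ , inj₂ refl) , β∉) =
    ±⇒∈KorseltSet q-prime 2≤l (+ q - + d) d (β∉ ∘ inj₁ ∘ sym) (β∉ ∘ inj₂) d∣ (inj₂ refl)
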